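{- There are exactly eight Lawvere-Tierney topologies on the category $\mathsf{BiColGraph}$ of bicoloured graphs. Their closure operators are as follows, for a bicoloured subgraph $A'\subseteq A$: $j^{00}$ adds nothing (discrete); $j^{01}$ adds $E$; $j^{02}$ adds $E'$; $j^{03}$ adds $E$ and $E'$; $j^{10}$ adds $V$; $j^{11}$ adds $V$ and $E$; $j^{12}$ adds $V$ and $E'$; $j^{13}$ adds everything (trivial), i.e. $V$, $E$ and $E'$.
   Context: $\mathsf{BiColGraph}$ is the category of functors $\mathsf C^{\mathrm{op}}\to\mathsf{Set}$ and natural transformations, where $\mathsf C^{\mathrm{op}}$ has three objects $V,E,E'$ and, besides identities, exactly the four morphisms $s,t\colon E\to V$ and $s',t'\colon E'\to V$. So a bicoloured graph has a set of vertices $A(V)$, a set of blue edges $A(E)$ and a set of red edges $A(E')$, each with source and target maps. In a presheaf category with Yoneda embedding $y$, the classifying object $\Omega$ has $\Omega(c)$ the Heyting algebra of subpresheaves of $y(c)$, functorial by pullback. A (Lawvere-Tierney) topology is a natural transformation $j\colon\Omega\to\Omega$ that preserves the top element, is idempotent, and preserves binary meets. The closure $\overline{A'}$ of $A'\subseteq A$ is the subobject of $A$ whose characteristic map is $j\circ\chi^{A'}$, where $\chi^{A'}\colon A\to\Omega$ is the characteristic map of $A'$; topologies correspond bijectively to closure operators in this way. "The closure adds $V$" means $\overline{A'}(V)=A(V)$; if it does not add $V$, then $\overline{A'}(V)=A'(V)$. "The closure adds $E$" means that $\overline{A'}(E)$ consists of all edges in $A(E)$ whose source and target both lie in $\overline{A'}(V)$;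 if it does not add $E$, then $\overline{A'}(E)=A'(E)$. Similarly for $E'$ (with $s',t'$). -}

module Defs where

open import Data.Bool using (Bool; true; false; if_then_else_)
open import Data.Product using (_×_; _,_; proj₁; proj₂)
open import Data.Unit.Polymorphic using (⊤; tt)
open import Function using (_⇔_; mk⇔; Func; Equivalence)
open import Function.Construct.Composition using (function)
open import Level using (Level; _⊔_) renaming (zero to 0ℓ; suc to lsuc)
open import Relation.Binary using (Setoid)
open import Relation.Binary.PropositionalEquality as ≡ using (_≡_; refl)

record Category : Set₁ where
  infix  4 _⇒_
  infixr 9 _∘_
  field
    Obj       : Set
    _⇒_       : Obj → Obj → Set
    id        : ∀ {c} → c ⇒ c
    _∘_       : ∀ {c d e} → d ⇒ e → c ⇒ d → c ⇒ e
    identityˡ : ∀ {c d} (f : c ⇒ d) → id ∘ f ≡ f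
    identityʳ : ∀ {c d} (f : c ⇒ d) → f ∘ id ≡ f
    assoc     : ∀ {b c d e} (h : d ⇒ e) (g : c ⇒ d) (f : b ⇒ c) →
                (h ∘ g) ∘ f ≡ h ∘ (g ∘ f)

-- Sets are rendered as setoids: the subpresheaves of y(c) are compared by
-- mutual inclusion, so only in this way is Ω itself a presheaf.
module Presheaves (C : Category) where
  open Category C

  record Presheaf (a r : Level) : Set (lsuc (a ⊔ r)) where
    field
      F₀ : Obj → Setoid a r
      F₁ : ∀ {c d} → c ⇒ d → Func (F₀ d) (F₀ c)

    infix 10 _∙_
    infix 4 _≈_

    Carrier : Obj → Set a
    Carrier c = Setoid.Carrier (F₀ c)

    _≈_ : ∀ {c} → Carrier c → Carrier c → Set r
    _≈_ {c} = Setoid._≈_ (F₀ c)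

    _∙_ : ∀ {c d} → Carrier d → c ⇒ d → Carrier c
    x ∙ f = Func.to (F₁ f) x

    field
      identity     : ∀ {c} (x : Carrier c) → x ∙ id ≈ x
      homomorphism : ∀ {c d e} (g : d ⇒ e) (f : c ⇒ d) (x : Carrier e) →
                     x ∙ (g ∘ f) ≈ (x ∙ g) ∙ f

  open Presheaf using (F₀; F₁; Carrier)

  record NatTrans {a r b s : Level} (A : Presheaf a r) (B : Presheaf b s) :
                  Set (a ⊔ r ⊔ b ⊔ s) where
    private
      module A = Presheaf A
      module B = Presheaf B
    field
      η       : ∀ c → Func (F₀ A c) (F₀ B c)
      natural : ∀ {c d} (f : c ⇒ d) (x : A.Carrier d) →
                Func.to (η c) (x A.∙ f) B.≈ Func.to (η d) x B.∙ f

    app : ∀ {c} → A.Carrier c → B.Carrier c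
    app {c} = Func.to (η c)

  open NatTrans using (η; natural; app)

  module _ {a r b s : Level} {A : Presheaf a r} {B : Presheaf b s} where
    private module B = Presheaf B

    infix 4 _≈ₙ_
    _≈ₙ_ : NatTrans A B → NatTrans A B → Set (a ⊔ s)
    α ≈ₙ β = ∀ c (x : Carrier A c) → app α x B.≈ app β x

  infixr 9 _∘ₙ_
  _∘ₙ_ : ∀ {a r b s p q} {A : Presheaf a r} {B : Presheaf b s} {D : Presheaf p q} →
         NatTrans B D → NatTrans A B → NatTrans A D
  _∘ₙ_ {D = D} β α = record
    { η       = λ c → function (η α c) (η β c)
    ; natural = λ {c} f x → Setoid.trans (F₀ D c)
                  (Func.cong (η β c) (natural α f x))
                  (natural β f (app α x))
    }

  record Subpresheaf {a r : Level} (ℓ : Level) (A : Presheaf a r) : Set (a ⊔ r ⊔ lsuc ℓ) where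
    private module A = Presheaf A
    infix 4 _∋_
    field
      _∋_      : ∀ {c} → A.Carrier c → Set ℓ
      resp     : ∀ {c} {x y : A.Carrier c} → x A.≈ y → _∋_ x → _∋_ y
      restrict : ∀ {c d} (f : c ⇒ d) {x : A.Carrier d} → _∋_ x → _∋_ (x A.∙ f)

  infix 4 _∈_
  _∈_ : ∀ {a r ℓ} {A : Presheaf a r} {c} → Carrier A c → Subpresheaf ℓ A → Set ℓ
  x ∈ S = Subpresheaf._∋_ S x

  open Subpresheaf using (resp; restrict)

  module _ {a r : Level} (A : Presheaf a r) (ℓ : Level) where

    Sub : Setoid (a ⊔ r ⊔ lsuc ℓ) (a ⊔ ℓ)
    Sub = record
      { Carrier       = Subpresheaf ℓ A
      ; _≈_           = λ S T → ∀ c (x : Carrier A c) → x ∈ S ⇔ x ∈ T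
      ; isEquivalence = record
        { refl  = λ _ x → mk⇔ (λ p → p) (λ p → p)
        ; sym   = λ S≈T c x → mk⇔ (Equivalence.from (S≈T c x)) (Equivalence.to (S≈T c x))
        ; trans = λ S≈T T≈U c x → mk⇔
            (λ p → Equivalence.to (T≈U c x) (Equivalence.to (S≈T c x) p))
            (λ p → Equivalence.from (S≈T c x) (Equivalence.from (T≈U c x) p))
        }
      }

  module _ {a r ℓ : Level} {A : Presheaf a r} where

    full : Subpresheaf ℓ A
    full = record { _∋_ = λ _ → ⊤ ; resp = λ _ _ → tt ; restrict = λ _ _ → tt }

    infixr 7 _∩_
    _∩_ : Subpresheaf ℓ A → Subpresheaf ℓ A → Subpresheaf ℓ A
    S ∩ T = record
      { _∋_      = λ x → x ∈ S × x ∈ T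
      ; resp     = λ x≈y (p , q) → resp S x≈y p , resp T x≈y q
      ; restrict = λ f (p , q) → restrict S f p , restrict T f q
      }

  pullback : ∀ {a r b s ℓ} {A : Presheaf a r} {B : Presheaf b s} →
             NatTrans A B → Subpresheaf ℓ B → Subpresheaf ℓ A
  pullback {B = B} α S = record
    { _∋_      = λ x → app α x ∈ S
    ; resp     = λ {c} x≈y → resp S (Func.cong (η α c) x≈y)
    ; restrict = λ {c} f {x} p →
        resp S (Setoid.sym (F₀ B c) (natural α f x)) (restrict S f p)
    }

  y : Obj → Presheaf 0ℓ 0ℓ
  y c = record
    { F₀           = λ d → ≡.setoid (d ⇒ c)
    ; F₁           = λ f → record { to = _∘ f ; cong = ≡.cong (_∘ f) }
    ; identity     = identityʳ
    ; homomorphism = λ g f h → ≡.sym (assoc h g f)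
    }

  y₁ : ∀ {c d} → c ⇒ d → NatTrans (y c) (y d)
  y₁ f = record
    { η       = λ _ → record { to = f ∘_ ; cong = ≡.cong (f ∘_) }
    ; natural = λ g h → ≡.sym (assoc f h g)
    }

  Ω : (ℓ : Level) → Presheaf (lsuc ℓ) ℓ
  Ω ℓ = record
    { F₀           = λ c → Sub (y c) ℓ
    ; F₁           = λ f → record
        { to   = pullback (y₁ f)
        ; cong = λ S≈T c h → S≈T c (f ∘ h)
        }
    ; identity     = λ S _ h → mk⇔ (resp S (identityˡ h)) (resp S (≡.sym (identityˡ h)))
    ; homomorphism = λ g f S _ h →
        mk⇔ (resp S (assoc g f h)) (resp S (≡.sym (assoc g f h)))
    }

  truth : ∀ {ℓ} → Subpresheaf ℓ (Ω ℓ)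
  truth {ℓ} = record
    { _∋_      = λ S → S Ω.≈ full
    ; resp     = λ S≈T S≈⊤ c h → mk⇔ (λ _ → tt)
        (λ _ → Equivalence.to (S≈T c h) (Equivalence.from (S≈⊤ c h) tt))
    ; restrict = λ f S≈⊤ c h → S≈⊤ c (f ∘ h)
    }
    where module Ω = Presheaf (Ω ℓ)

  -- The characteristic map: χ A′ x is the sieve of all f with x ∙ f in A′.
  χ : ∀ {a r ℓ} {A : Presheaf a r} → Subpresheaf ℓ A → NatTrans A (Ω ℓ)
  χ {A = A} A′ = record
    { η       = λ c → record
        { to   = λ x → record
            { _∋_      = λ f → (x A.∙ f) ∈ A′
            ; resp     = λ { refl p → p }
            ; restrict = λ g {f} p → resp A′ (sym (A.homomorphism f g x)) (restrict A′ g p)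
            }
        ; cong = λ x≈y _ f → mk⇔ (resp A′ (Func.cong (A.F₁ f) x≈y))
                               (resp A′ (sym (Func.cong (A.F₁ f) x≈y)))
        }
    ; natural = λ f x _ g → mk⇔ (resp A′ (sym (A.homomorphism f g x)))
                              (resp A′ (A.homomorphism f g x))
    }
    where
    module A = Presheaf A
    sym = λ {c} {x} {y} → Setoid.sym (A.F₀ c) {x} {y}

  -- The next two lemmas say that Ω classifies subobjects: pulling truth back
  -- along φ gives the unique subobject with characteristic map φ.
  χ-pullback-truth : ∀ {a r ℓ} {A : Presheaf a r} (φ : NatTrans A (Ω ℓ)) →
                     χ (pullback φ truth) ≈ₙ φ
  χ-pullback-truth φ _ x c f = mk⇔
    (λ p → resp (app φ x) (identityʳ f)
             (Equivalence.to (natural φ f x c id) (Equivalence.from (p c id) tt)))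
    (λ p d h → mk⇔ (λ _ → tt) (λ _ →
             Equivalence.from (natural φ f x d h) (restrict (app φ x) h p)))

  pullback-truth-χ : ∀ {a r ℓ} {A : Presheaf a r} (A′ : Subpresheaf ℓ A) →
                     ∀ c (x : Carrier A c) → x ∈ pullback (χ A′) truth ⇔ x ∈ A′
  pullback-truth-χ {A = A} A′ c x = mk⇔
    (λ p → resp A′ (A.identity x) (Equivalence.from (p c id) tt))
    (λ p _ f → mk⇔ (λ _ → tt) (λ _ → restrict A′ f p))
    where module A = Presheaf A

  record LawvereTierney (ℓ : Level) : Set (lsuc ℓ) where
    private module Ω = Presheaf (Ω ℓ)
    field
      j          : NatTrans (Ω ℓ) (Ω ℓ)
      j-⊤        : ∀ {c} → app j {c} full Ω.≈ full
      idempotent : j ∘ₙ j ≈ₙ j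
      j-∩        : ∀ {c} (S T : Ω.Carrier c) → app j (S ∩ T) Ω.≈ app j S ∩ app j T

    closure : ∀ {a r} {A : Presheaf a r} → Subpresheaf ℓ A → Subpresheaf ℓ A
    closure A′ = pullback (j ∘ₙ χ A′) truth

  LawvereTierneySetoid : ∀ ℓ → Setoid (lsuc ℓ) (lsuc ℓ)
  LawvereTierneySetoid ℓ = record
    { Carrier       = LawvereTierney ℓ
    ; _≈_           = λ J K → LawvereTierney.j J ≈ₙ LawvereTierney.j K
    ; isEquivalence = record
      { refl  = λ {J} c S → Ω.refl c {app (LawvereTierney.j J) S}
      ; sym   = λ {J} {K} J≈K c S →
          Ω.sym c {app (LawvereTierney.j J) S} {app (LawvereTierney.j K) S} (J≈K c S)
      ; trans = λ {J} {K} {L} J≈K K≈L c S →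
          Ω.trans c {app (LawvereTierney.j J) S} {app (LawvereTierney.j K) S}
                    {app (LawvereTierney.j L) S} (J≈K c S) (K≈L c S)
      }
    }
    where module Ω c = Setoid (F₀ (Ω ℓ) c)

data Sort : Set where
  V E E′ : Sort

data Arrow : Sort → Sort → Set where
  id    : ∀ {c} → Arrow c c
  s t   : Arrow V E
  s′ t′ : Arrow V E′

-- Graphs are presheaves on ℂ, so the arrows of ℂ run from vertices to edges,
-- and the source of an edge x is its restriction x ∙ s.
ℂ : Category
ℂ = record
  { Obj       = Sort
  ; _⇒_       = Arrow
  ; id        = id
  ; _∘_       = comp
  ; identityˡ = λ _ → refl
  ; identityʳ = comp-id
  ; assoc     = comp-assoc
  }
  where
  comp : ∀ {c d e} → Arrow d e → Arrow c d → Arrow c e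
  comp id g  = g
  comp s  id = s
  comp t  id = t
  comp s′ id = s′
  comp t′ id = t′

  comp-id : ∀ {c d} (f : Arrow c d) → comp f id ≡ f
  comp-id id = refl
  comp-id s  = refl
  comp-id t  = refl
  comp-id s′ = refl
  comp-id t′ = refl

  comp-assoc : ∀ {b c d e} (h : Arrow d e) (g : Arrow c d) (f : Arrow b c) →
               comp (comp h g) f ≡ comp h (comp g f)
  comp-assoc id g  f = refl
  comp-assoc s  id f = refl
  comp-assoc t  id f = refl
  comp-assoc s′ id f = refl
  comp-assoc t′ id f = refl

open Presheaves ℂ public

BiColGraph : ∀ a r → Set (lsuc (a ⊔ r))
BiColGraph = Presheaf

data Name : Set where
  j⁰⁰ j⁰¹ j⁰² j⁰³ j¹⁰ j¹¹ j¹² j¹³ : Name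

adds : Name → Sort → Bool
adds j⁰⁰ V = false ; adds j⁰⁰ E = false ; adds j⁰⁰ E′ = false
adds j⁰¹ V = false ; adds j⁰¹ E = true  ; adds j⁰¹ E′ = false
adds j⁰² V = false ; adds j⁰² E = false ; adds j⁰² E′ = true
adds j⁰³ V = false ; adds j⁰³ E = true  ; adds j⁰³ E′ = true
adds j¹⁰ V = true  ; adds j¹⁰ E = false ; adds j¹⁰ E′ = false
adds j¹¹ V = true  ; adds j¹¹ E = true  ; adds j¹¹ E′ = false
adds j¹² V = true  ; adds j¹² E = false ; adds j¹² E′ = true
adds j¹³ V = true  ; adds j¹³ E = true  ; adds j¹³ E′ = true

-- A″ stands for the closure of A′; note that the endpoints of an added edge are
-- required to lie in A″, not in A′.
module _ {a r ℓ : Level} {A : BiColGraph a r} (A′ A″ : Subpresheaf ℓ A) where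
  open Presheaf A using (Carrier; _∙_)

  Added : Sort → Set (a ⊔ ℓ)
  Added V  = (v : Carrier V) → v ∈ A″
  Added E  = (x : Carrier E) → x ∈ A″ ⇔ ((x ∙ s) ∈ A″ × (x ∙ t) ∈ A″)
  Added E′ = (x : Carrier E′) → x ∈ A″ ⇔ ((x ∙ s′) ∈ A″ × (x ∙ t′) ∈ A″)

  NotAdded : Sort → Set (a ⊔ ℓ)
  NotAdded c = (x : Carrier c) → x ∈ A″ ⇔ x ∈ A′

  AddsExactly : (Sort → Bool) → Set (a ⊔ ℓ)
  AddsExactly b = ∀ c → if b c then Added c else NotAdded c

{-# OPTIONS --safe #-}
-- A topology J is determined by the three truth values id ∈ j (∂ c), where ∂ c
-- is the sieve of all non-identity arrows into c.  By naturality j S is known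
-- once we know when id ∈ j S.  If id ∈ j (∂ c), then id ∈ j S iff ∂ c ⊆ j S,
-- by idempotence; otherwise id ∈ j S iff id ∈ S, since a sieve without id lies
-- in ∂ c.  Conversely, each choice of truth values yields a closure operator,
-- which can be described on an arbitrary graph.
module Submission where

open import Defs
open import Axiom.ExcludedMiddle using (ExcludedMiddle)
open import Data.Bool using (Bool; true; false; if_then_else_)
open import Data.Empty.Polymorphic using (⊥; ⊥-elim)
open import Data.Product using (Σ-syntax; _×_; _,_; proj₁; proj₂)
open import Data.Unit.Polymorphic using (⊤; tt)
open import Function using (Bijection; Equivalence; module Func; _⇔_; mk⇔)
open import Function.Construct.Symmetry using (⇔-sym)
open import Level using (Level)
open import Relation.Binary using (Setoid)
open import Relation.Binary.PropositionalEquality using (_≡_; refl; sym; trans; subst; setoid)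
open import Relation.Nullary using (¬_; Dec; _because_; does; proof; contradiction)
open import Relation.Nullary.Decidable using (decidable-stable; does-⇔)
open import Relation.Nullary.Reflects using (Reflects; ofʸ; ofⁿ)

open Category ℂ using (_∘_)
open Presheaf using (Carrier)
open Subpresheaf using (resp; restrict)
open NatTrans using (η; app; natural)
open Equivalence using (to; from)

-- Closure operators on an arbitrary bicoloured graph.

module _ {a r ℓ : Level} (b : Sort → Bool) {A : BiColGraph a r} (A′ : Subpresheaf ℓ A) where
  private module A = Presheaf A

  -- Taking `A` to be `y c` yields the map on `Ω`; keeping `A` arbitrary yields the closure with
  -- which that map is later compared.
  Closed : ∀ c → Carrier A c → Set ℓ
  Closed V  x = if b V  then ⊤ else x ∈ A′
  Closed E  x = if b E  then Closed V (x A.∙ s)  × Closed V (x A.∙ t)  else x ∈ A′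
  Closed E′ x = if b E′ then Closed V (x A.∙ s′) × Closed V (x A.∙ t′) else x ∈ A′

  Closed-inflationary : ∀ c {x} → x ∈ A′ → Closed c x
  Closed-inflationary V p with b V
  ... | true  = tt
  ... | false = p
  Closed-inflationary E p with b E
  ... | true  = Closed-inflationary V (restrict A′ s p) , Closed-inflationary V (restrict A′ t p)
  ... | false = p
  Closed-inflationary E′ p with b E′
  ... | true  = Closed-inflationary V (restrict A′ s′ p) , Closed-inflationary V (restrict A′ t′ p)
  ... | false = p

module _ {a r a′ r′ ℓ : Level} (b : Sort → Bool)
         {A : BiColGraph a r} {A′ : Subpresheaf ℓ A}
         {B : BiColGraph a′ r′} {B′ : Subpresheaf ℓ B} where
  private
    module A = Presheaf A
    module B = Presheaf B

  Closed-map-V : ∀ {x y} → (x ∈ A′ → y ∈ B′) → Closed b A′ V x → Closed b B′ V y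
  Closed-map-V h p with b V
  ... | true  = tt
  ... | false = h p

  ∈-map : ∀ {c} {x : Carrier A c} {y : Carrier B c} →
          (∀ {d} (f : Arrow d c) → (x A.∙ f) ∈ A′ → (y B.∙ f) ∈ B′) →
          x ∈ A′ → y ∈ B′
  ∈-map {c} {x} {y} h p = resp B′ (B.identity y)
    (h id (resp A′ (Setoid.sym (A.F₀ c) (A.identity x)) p))

  -- Only the sieve of all f with x ∙ f in A′ matters for x to be in the closure.
  Closed-map : ∀ c {x : Carrier A c} {y : Carrier B c} →
               (∀ {d} (f : Arrow d c) → (x A.∙ f) ∈ A′ → (y B.∙ f) ∈ B′) →
               Closed b A′ c x → Closed b B′ c y
  Closed-map V h p = Closed-map-V (∈-map h) p
  Closed-map E h p with b E
  ... | true  = Closed-map-V (h s) (proj₁ p) , Closed-map-V (h t) (proj₂ p)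
  ... | false = ∈-map h p
  Closed-map E′ h p with b E′
  ... | true  = Closed-map-V (h s′) (proj₁ p) , Closed-map-V (h t′) (proj₂ p)
  ... | false = ∈-map h p

module _ {a r ℓ : Level} (b : Sort → Bool) {A : BiColGraph a r} where
  private module A = Presheaf A

  cl : Subpresheaf ℓ A → Subpresheaf ℓ A
  cl A′ = record { _∋_ = λ {c} → Closed b A′ c ; resp = λ {c} → cl-resp {c} ; restrict = cl-restrict }
    where
    cl-resp : ∀ {c} {x y : Carrier A c} → x A.≈ y → Closed b A′ c x → Closed b A′ c y
    cl-resp {c} x≈y = Closed-map b c λ f → resp A′ (Func.cong (A.F₁ f) x≈y)

    cl-restrict : ∀ {c d} (f : Arrow c d) {x} → Closed b A′ d x → Closed b A′ c (x A.∙ f)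
    cl-restrict {c} id {x} = cl-resp {c} (Setoid.sym (A.F₀ c) (A.identity x))
    -- If `E` is added, membership of an edge is by definition membership of its endpoints;
    -- otherwise the edge lies in `A′`, and so does its source.
    cl-restrict s p with b E
    ... | true  = proj₁ p
    ... | false = Closed-inflationary b A′ V (restrict A′ s p)
    cl-restrict t p with b E
    ... | true  = proj₂ p
    ... | false = Closed-inflationary b A′ V (restrict A′ t p)
    cl-restrict s′ p with b E′
    ... | true  = proj₁ p
    ... | false = Closed-inflationary b A′ V (restrict A′ s′ p)
    cl-restrict t′ p with b E′
    ... | true  = proj₂ p
    ... | false = Closed-inflationary b A′ V (restrict A′ t′ p)

  -- A sort that is not added keeps its elements at both applications, and an added edge only asks
  -- about its endpoints, so the vertices decide.
  cl-idempotent : (A′ : Subpresheaf ℓ A) → ∀ c {x : Carrier A c} → x ∈ cl (cl A′) → x ∈ cl A′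
  cl-idempotent A′ V p with b V
  ... | true  = tt
  ... | false = p
  cl-idempotent A′ E p with b E
  ... | true  = cl-idempotent A′ V (proj₁ p) , cl-idempotent A′ V (proj₂ p)
  ... | false = p
  cl-idempotent A′ E′ p with b E′
  ... | true  = cl-idempotent A′ V (proj₁ p) , cl-idempotent A′ V (proj₂ p)
  ... | false = p

  -- The condition on an added edge is a conjunction of vertex conditions, and conjunctions can be
  -- regrouped. The converse inclusion is monotonicity, an instance of `Closed-map`.
  cl-∩ : (A′ B′ : Subpresheaf ℓ A) → ∀ c {x : Carrier A c} →
         x ∈ cl A′ ∩ cl B′ → x ∈ cl (A′ ∩ B′)
  cl-∩ A′ B′ V p with b V
  ... | true  = tt
  ... | false = p
  cl-∩ A′ B′ E p with b E
  cl-∩ A′ B′ E ((p , q) , (p′ , q′)) | true = cl-∩ A′ B′ V (p , p′) , cl-∩ A′ B′ V (q , q′)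
  ... | false = p
  cl-∩ A′ B′ E′ p with b E′
  cl-∩ A′ B′ E′ ((p , q) , (p′ , q′)) | true = cl-∩ A′ B′ V (p , p′) , cl-∩ A′ B′ V (q , q′)
  ... | false = p

  cl-addsExactly : (A′ : Subpresheaf ℓ A) → AddsExactly A′ (cl A′) b
  cl-addsExactly A′ V with b V
  ... | true  = λ _ → tt
  ... | false = λ _ → mk⇔ (λ p → p) (λ p → p)
  cl-addsExactly A′ E with b E
  ... | true  = λ _ → mk⇔ (λ p → p) (λ p → p)
  ... | false = λ _ → mk⇔ (λ p → p) (λ p → p)
  cl-addsExactly A′ E′ with b E′
  ... | true  = λ _ → mk⇔ (λ p → p) (λ p → p)
  ... | false = λ _ → mk⇔ (λ p → p) (λ p → p)

  -- Carries the description from `cl`, where it holds by construction, to the closure of a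
  -- topology, which agrees with `cl` only up to mutual inclusion.
  AddsExactly-resp : (A′ : Subpresheaf ℓ A) {A″ B″ : Subpresheaf ℓ A} →
                     (∀ c (x : Carrier A c) → x ∈ A″ ⇔ x ∈ B″) →
                     AddsExactly A′ A″ b → AddsExactly A′ B″ b
  AddsExactly-resp A′ eq adds V with b V | adds V
  ... | true  | h = λ v → to (eq V v) (h v)
  ... | false | h = λ v → mk⇔ (λ p → to (h v) (from (eq V v) p)) (λ p → to (eq V v) (from (h v) p))
  AddsExactly-resp A′ eq adds E with b E | adds E
  ... | true  | h = λ x → mk⇔
    (λ p → let (u , v) = to (h x) (from (eq E x) p) in to (eq V _) u , to (eq V _) v)
    (λ (u , v) → to (eq E x) (from (h x) (from (eq V _) u , from (eq V _) v)))
  ... | false | h = λ x → mk⇔ (λ p → to (h x) (from (eq E x) p)) (λ p → to (eq E x) (from (h x) p))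
  AddsExactly-resp A′ eq adds E′ with b E′ | adds E′
  ... | true  | h = λ x → mk⇔
    (λ p → let (u , v) = to (h x) (from (eq E′ x) p) in to (eq V _) u , to (eq V _) v)
    (λ (u , v) → to (eq E′ x) (from (h x) (from (eq V _) u , from (eq V _) v)))
  ... | false | h = λ x → mk⇔ (λ p → to (h x) (from (eq E′ x) p)) (λ p → to (eq E′ x) (from (h x) p))

-- The topology of each choice of sorts, and how topologies are told apart.

module _ {ℓ : Level} where

  topology : (Sort → Bool) → LawvereTierney ℓ
  topology b = record
    { j = record
      { η = λ _ → record
        { to   = cl b
        ; cong = λ S≈T c f → mk⇔
            (Closed-map b c λ g → to (S≈T _ (f ∘ g)))
            (Closed-map b c λ g → from (S≈T _ (f ∘ g)))
        }
      ; natural = λ f S c g → mk⇔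
          (Closed-map b c λ h → resp S (sym (assoc f g h)))
          (Closed-map b c λ h → resp S (assoc f g h))
      }
    ; j-⊤        = λ c f → mk⇔ (λ _ → tt) (λ _ → Closed-inflationary b full c {f} tt)
    ; idempotent = λ _ S c f → mk⇔ (cl-idempotent b S c) (Closed-inflationary b (cl b S) c)
    ; j-∩        = λ S T c f → mk⇔
        (λ p → Closed-map b c (λ _ → proj₁) p , Closed-map b c (λ _ → proj₂) p)
        (cl-∩ b S T c)
    }
    where open Category ℂ using (assoc)

  -- An element lies in the closure when the closed sieve `cl b (app (χ A′) x)` is full, that is,
  -- when this sieve contains `id`.
  closure⇔cl : ∀ {a r} b {A : BiColGraph a r} (A′ : Subpresheaf ℓ A) c (x : Carrier A c) →
               x ∈ LawvereTierney.closure (topology b) A′ ⇔ x ∈ cl b A′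
  closure⇔cl b {A} A′ c x = mk⇔
    -- Since `id ∘ f` reduces to `f`, the restrictions of `id` and of `x` satisfy the same
    -- membership conditions, and the identity map serves.
    (λ p → Closed-map b c (λ _ q → q) (from (p c id) tt))
    (λ p d f → mk⇔ (λ _ → tt)
      (λ _ → restrict (cl b (app (χ A′) x)) f (Closed-map b c (λ _ q → q) p)))

  NonIdentity : ∀ {c d} → Arrow c d → Set ℓ
  NonIdentity id = ⊥
  NonIdentity _  = ⊤

  ∂ : ∀ c → Subpresheaf ℓ (y c)
  ∂ c = record
    { _∋_      = NonIdentity
    ; resp     = λ { refl p → p }
    ; restrict = λ { id {s} p → p ; id {t} p → p ; id {s′} p → p ; id {t′} p → p }
    }

  -- Both endpoint arrows of an edge sort lie in its `∂`, so adding the sort puts `id` into the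
  -- closure; otherwise `id` would have to lie in `∂ c` itself.
  id∈cl∂-reflects : ∀ b c → Reflects (id ∈ cl b (∂ c)) (b c)
  id∈cl∂-reflects b V with b V
  ... | true  = ofʸ tt
  ... | false = ofⁿ ⊥-elim
  id∈cl∂-reflects b E with b E
  ... | true  = ofʸ (Closed-inflationary b (∂ E) V {s} tt , Closed-inflationary b (∂ E) V {t} tt)
  ... | false = ofⁿ ⊥-elim
  id∈cl∂-reflects b E′ with b E′
  ... | true  = ofʸ (Closed-inflationary b (∂ E′) V {s′} tt , Closed-inflationary b (∂ E′) V {t′} tt)
  ... | false = ofⁿ ⊥-elim

  topology-injective : ∀ {b b′} →
    Setoid._≈_ (LawvereTierneySetoid ℓ) (topology b) (topology b′) → ∀ c → b c ≡ b′ c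
  topology-injective {b} {b′} b≈b′ c =
    does-⇔ (b≈b′ c (∂ c) c id) (b c because id∈cl∂-reflects b c) (b′ c because id∈cl∂-reflects b′ c)

-- Uniqueness of a topology with given values on the sieves `∂ c`.

module _ {ℓ : Level} (J : LawvereTierney ℓ) where
  open LawvereTierney J
  private module Ω = Presheaf (Ω ℓ)

  infix 4 _⊆_
  _⊆_ : ∀ {c} → Ω.Carrier c → Ω.Carrier c → Set ℓ
  S ⊆ T = ∀ {c} (f : Arrow c _) → f ∈ S → f ∈ T

  -- If `S ⊆ T` then `S` equals `S ∩ T`, and `j` preserves this meet.
  j-monotone : ∀ {c} {S T : Ω.Carrier c} → S ⊆ T → app j S ⊆ app j T
  j-monotone {S = S} {T} S⊆T f p = proj₂ (to (j-∩ S T _ f) (to (Func.cong (η j _)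
    {S} {S ∩ T} (λ _ g → mk⇔ (λ q → q , S⊆T g q) proj₁) _ f) p))

  -- A sieve containing `id` is full, and `j` preserves the top element.
  id∈⇒id∈j : ∀ {c} (S : Ω.Carrier c) → id ∈ S → id ∈ app j S
  id∈⇒id∈j S p = j-monotone {S = full} {S} (λ f _ → restrict S f p) id (from (j-⊤ _ id) tt)

  id∈j∂⇒ : ∀ {c} (S : Ω.Carrier c) → id ∈ app j (∂ c) → ∂ c ⊆ app j S → id ∈ app j S
  id∈j∂⇒ {c} S dense ∂⊆jS =
    to (idempotent c S c id) (j-monotone {S = ∂ c} {app j S} ∂⊆jS id dense)

  -- The argument is classical: were `id` outside `S`, then `S ⊆ ∂ c`, and monotonicity would put
  -- `id` into `j (∂ c)`.
  id∉j∂⇒ : ExcludedMiddle ℓ → ∀ {c} (S : Ω.Carrier c) →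
           ¬ (id ∈ app j (∂ c)) → id ∈ app j S → id ∈ S
  id∉j∂⇒ em {c} S id∉j∂ p = decidable-stable em λ id∉S →
    id∉j∂ (j-monotone {S = S} {∂ c} (S⊆∂ id∉S) id p)
    where
    S⊆∂ : ¬ (id ∈ S) → S ⊆ ∂ c
    S⊆∂ id∉S id q = contradiction q id∉S
    S⊆∂ id∉S s  _ = tt
    S⊆∂ id∉S t  _ = tt
    S⊆∂ id∉S s′ _ = tt
    S⊆∂ id∉S t′ _ = tt

  -- Naturality of `j` along `f`, evaluated at `id`.
  ∈j⇔id∈j : ∀ {c d} (S : Ω.Carrier d) (f : Arrow c d) → f ∈ app j S ⇔ id ∈ app j (S Ω.∙ f)
  ∈j⇔id∈j S f = mk⇔
    (λ p → from (natural j f S _ id) (resp (app j S) (sym (identityʳ f)) p))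
    (λ p → resp (app j S) (identityʳ f) (to (natural j f S _ id) p))
    where open Category ℂ using (identityʳ)

  topology-unique : ExcludedMiddle ℓ → (b : Sort → Bool) →
                    (∀ c → Reflects (id ∈ app j (∂ c)) (b c)) →
                    Setoid._≈_ (LawvereTierneySetoid ℓ) (topology b) J
  topology-unique em b r d S c f = everywhere (at-id c) S f
    where
    everywhere : ∀ {c} → (∀ S → id ∈ cl b S ⇔ id ∈ app j {c} S) →
                 ∀ {d} (S : Ω.Carrier d) (f : Arrow c d) → f ∈ cl b S ⇔ f ∈ app j S
    everywhere {c} at-id S f = mk⇔
      (λ p → from (∈j⇔id∈j S f) (to (at-id (S Ω.∙ f)) (Closed-map b c (λ _ q → q) p)))
      (λ p → Closed-map b c (λ _ q → q) (from (at-id (S Ω.∙ f)) (to (∈j⇔id∈j S f) p)))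

    at-V : (S : Ω.Carrier V) → id ∈ cl b S ⇔ id ∈ app j S
    at-V S with b V | r V
    -- No arrow into `V` but `id` exists, so `∂ V` is empty and its inclusion in `j S` is vacuous.
    ... | true  | ofʸ dense = mk⇔ (λ _ → id∈j∂⇒ S dense λ { id () }) (λ _ → tt)
    ... | false | ofⁿ ¬dense = mk⇔ (id∈⇒id∈j S) (id∉j∂⇒ em S ¬dense)

    -- Vertices come first: at an edge sort, the inclusion of `∂` in `j S` concerns only the two
    -- arrows from `V`.
    vertex : ∀ {d} (S : Ω.Carrier d) (f : Arrow V d) → f ∈ cl b S ⇔ f ∈ app j S
    vertex = everywhere at-V

    at-id : ∀ c (S : Ω.Carrier c) → id ∈ cl b S ⇔ id ∈ app j S
    at-id V S = at-V S
    at-id E S with b E | r E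
    ... | true  | ofʸ dense = mk⇔
      (λ (p , q) → id∈j∂⇒ S dense λ
        { s _ → to (vertex S s) p
        ; t _ → to (vertex S t) q })
      (λ p → from (vertex S s) (restrict (app j S) s p) , from (vertex S t) (restrict (app j S) t p))
    ... | false | ofⁿ ¬dense = mk⇔ (id∈⇒id∈j S) (id∉j∂⇒ em S ¬dense)
    at-id E′ S with b E′ | r E′
    ... | true  | ofʸ dense = mk⇔
      (λ (p , q) → id∈j∂⇒ S dense λ
        { s′ _ → to (vertex S s′) p
        ; t′ _ → to (vertex S t′) q })
      (λ p → from (vertex S s′) (restrict (app j S) s′ p) , from (vertex S t′) (restrict (app j S) t′ p))
    ... | false | ofⁿ ¬dense = mk⇔ (id∈⇒id∈j S) (id∉j∂⇒ em S ¬dense)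

-- The eight names as Boolean choices, and the classification.

name : (Sort → Bool) → Name
name b = if b V
  then (if b E then (if b E′ then j¹³ else j¹¹) else (if b E′ then j¹² else j¹⁰))
  else (if b E then (if b E′ then j⁰³ else j⁰¹) else (if b E′ then j⁰² else j⁰⁰))

name-cong : ∀ {b b′} → (∀ c → b c ≡ b′ c) → name b ≡ name b′
name-cong b≗b′ rewrite b≗b′ V | b≗b′ E | b≗b′ E′ = refl

name-adds : ∀ n → name (adds n) ≡ n
name-adds j⁰⁰ = refl
name-adds j⁰¹ = refl
name-adds j⁰² = refl
name-adds j⁰³ = refl
name-adds j¹⁰ = refl
name-adds j¹¹ = refl
name-adds j¹² = refl
name-adds j¹³ = refl

adds-name : ∀ b c → adds (name b) c ≡ b c
adds-name b V with b V | b E | b E′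
... | true  | true  | true  = refl
... | true  | true  | false = refl
... | true  | false | true  = refl
... | true  | false | false = refl
... | false | true  | true  = refl
... | false | true  | false = refl
... | false | false | true  = refl
... | false | false | false = refl
adds-name b E with b V | b E | b E′
... | true  | true  | true  = refl
... | true  | true  | false = refl
... | true  | false | true  = refl
... | true  | false | false = refl
... | false | true  | true  = refl
... | false | true  | false = refl
... | false | false | true  = refl
... | false | false | false = refl
adds-name b E′ with b V | b E | b E′
... | true  | true  | true  = refl
... | true  | true  | false = refl
... | true  | false | true  = refl
... | true  | false | false = refl
... | false | true  | true  = refl
... | false | true  | false = refl
... | false | false | true  = refl
... | false | false | false = refl

-- `name` is a left inverse of `adds` and depends only on the values at the three sorts.
adds-injective : ∀ {m n} → (∀ c → adds m c ≡ adds n c) → m ≡ n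
adds-injective {m} {n} eq = trans (sym (name-adds m)) (trans (name-cong eq) (name-adds n))

Name⤖LawvereTierney : ∀ {ℓ} → ExcludedMiddle ℓ → Bijection (setoid Name) (LawvereTierneySetoid ℓ)
Name⤖LawvereTierney {ℓ} em = record
  { to        = λ n → topology (adds n)
  ; cong      = λ { {n} refl → LT.refl {topology (adds n)} }
  ; bijective = (λ eq → adds-injective (topology-injective eq)) , surjective
  }
  where
  module LT = Setoid (LawvereTierneySetoid ℓ)

  surjective : ∀ J → Σ[ n ∈ Name ] (∀ {m} → m ≡ n → topology (adds m) LT.≈ J)
  -- The name records for which `c` the sieve `∂ c` is dense for `J`. Its bits agree with `dense`
  -- only pointwise, hence the transport along `adds-name`.
  surjective J = name dense , λ { refl → topology-unique J em (adds (name dense)) λ c →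
    subst (Reflects _) (sym (adds-name dense c)) (proof (dense? c)) }
    where
    dense? : ∀ c → Dec (id ∈ app (LawvereTierney.j J) (∂ c))
    dense? _ = em

    dense : Sort → Bool
    dense c = does (dense? c)

lemma58 : ∀ {a r ℓ} → ExcludedMiddle ℓ →
    Σ[ topology ∈ Bijection (setoid Name) (LawvereTierneySetoid ℓ) ]
    (∀ (n : Name) (A : BiColGraph a r) (A′ : Subpresheaf ℓ A) →
    AddsExactly A′ (LawvereTierney.closure (Bijection.to topology n) A′) (adds n))
lemma58 em = Name⤖LawvereTierney em , λ n A A′ →
  AddsExactly-resp (adds n) A′
    (λ c x → ⇔-sym (closure⇔cl (adds n) A′ c x))
    (cl-addsExactly (adds n) A′)
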